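{- Let $f : \mathbb{Z}_{\geqslant 1} \to \mathbb{C}$ be an arithmetic function and for real $x \geqslant 1$ set $$S_{r}(x)=\sum_{n_{1}\leqslant x,\dots,n_{r}\leqslant x}\left( f ( n_1 ) + \dotsb + f ( n_r ) \right) \left \lfloor \frac{x}{n_1 \dotsb n_r}\right \rfloor .$$ Define recursively $$T_{1}(x)=\sum_{n \leqslant x} \left \lfloor \frac{x}{n} \right \rfloor (f \star \mathbf{1}) (n), \qquad T_{r}(x) = \sum_{n \leqslant x} T_{r-1} \left( \frac{x}{n} \right) \quad ( r \in \mathbb{Z}_{\geqslant 2} ).$$ Then for every $r \in \mathbb{Z}_{\geqslant 2}$ and every real $x \geqslant 1$, $S_{r}(x)=r\, T_{r-1}(x)$.
   Context: $\lfloor\cdot\rfloor$ is the integer part; sums run over positive integers. $\mathbf{1}$ is the constant function $1$, and $(F \star G)(n) := \sum_{d \mid n} F(d) G(n/d)$ is Dirichlet convolution. -}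

module Defs where

open import Algebra.Bundles using (CommutativeRing; CommutativeMonoid)
open import Algebra.Construct.DirectProduct using (commutativeMonoid)
import Algebra.Definitions.RawMonoid as RawMonoidDefs
open import Data.Fin.Base using (Fin; toℕ)
open import Data.Nat.Base as ℕ using (ℕ; zero; suc; NonZero)
open import Data.Nat.Divisibility using (_∣_; _∣?_; quotient; quotient≢0)
import Data.Nat.Properties as ℕ
open import Data.Product.Base using (_×_; _,_; ∃)
open import Data.Vec.Functional using (Vector; []; _∷_; foldr)
open import Level using (Level; _⊔_) renaming (suc to lsuc)
open import Relation.Binary.Core using (Rel)
open import Relation.Binary.Structures using (IsDecTotalOrder)
open import Relation.Nullary.Decidable using (Dec; yes; no)
open import Relation.Nullary.Negation using (¬_)
open import Relation.Unary using (Pred)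

-- The real numbers, given by their classical axioms: a Dedekind-complete
-- (hence, classically, unique) ordered field.  The order is decidable, as it
-- is classically; this is what makes the integer part a function.
record Reals (c ℓ₁ ℓ₂ : Level) : Set (lsuc (c ⊔ ℓ₁ ⊔ ℓ₂)) where
  field
    commutativeRing : CommutativeRing c ℓ₁

  open CommutativeRing commutativeRing public
  open RawMonoidDefs +-rawMonoid using () renaming (_×_ to _·_)

  infix 4 _≤_
  infix 8 _⁻¹

  fromℕ : ℕ → Carrier
  fromℕ n = n · 1#

  field
    _⁻¹             : Carrier → Carrier
    -- The value of 0# ⁻¹ is unspecified.
    ⁻¹-inverseʳ     : ∀ x → ¬ x ≈ 0# → x * x ⁻¹ ≈ 1#
    1≉0             : ¬ 1# ≈ 0#
    _≤_             : Rel Carrier ℓ₂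
    isDecTotalOrder : IsDecTotalOrder _≈_ _≤_
    +-monoˡ-≤       : ∀ z {x y} → x ≤ y → x + z ≤ y + z
    *-nonNegative   : ∀ {x y} → 0# ≤ x → 0# ≤ y → 0# ≤ x * y
    -- Classically this follows from completeness; here it also supplies the
    -- bound from which the integer part is computed.
    archimedean     : ∀ x → ∃ λ n → x ≤ fromℕ n

  _IsUpperBoundOf_ : Carrier → Pred Carrier (c ⊔ ℓ₁ ⊔ ℓ₂) → Set (c ⊔ ℓ₁ ⊔ ℓ₂)
  b IsUpperBoundOf P = ∀ y → P y → y ≤ b

  field
    complete        : (P : Pred Carrier (c ⊔ ℓ₁ ⊔ ℓ₂)) → ∃ P →
                      ∃ (_IsUpperBoundOf P) →
                      ∃ λ s → s IsUpperBoundOf P ×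
                              (∀ b → b IsUpperBoundOf P → s ≤ b)

  open IsDecTotalOrder isDecTotalOrder public using (_≤?_)

-- The proof field is irrelevant, so equality in ℕ⁺ is equality of values.
record ℕ⁺ : Set where
  constructor mk⁺
  field
    value        : ℕ
    .{{nonZero}} : NonZero value

open ℕ⁺ public using (value)

1⁺ : ℕ⁺
1⁺ = mk⁺ 1

infixl 7 _*⁺_
_*⁺_ : ℕ⁺ → ℕ⁺ → ℕ⁺
mk⁺ m *⁺ mk⁺ n = mk⁺ (m ℕ.* n) {{ℕ.m*n≢0 m n}}

product⁺ : ∀ {r} → Vector ℕ⁺ r → ℕ⁺
product⁺ = foldr _*⁺_ 1⁺

quotient⁺ : ∀ {d} (n : ℕ⁺) → d ∣ value n → ℕ⁺
quotient⁺ (mk⁺ n) d∣n = mk⁺ (quotient d∣n) {{quotient≢0 d∣n}}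

-- Fin N enumerates the positive integers 1, …, N.
index⁺ : ∀ {N} → Fin N → ℕ⁺
index⁺ i = mk⁺ (suc (toℕ i))

module Arithmetic {c ℓ₁ ℓ₂ : Level} (R : Reals c ℓ₁ ℓ₂) where

  private module ℝ = Reals R

  ℝ : Set c
  ℝ = ℝ.Carrier

  infix 4 _≤ℝ_
  _≤ℝ_ : ℝ → ℝ → Set ℓ₂
  _≤ℝ_ = ℝ._≤_

  1ℝ : ℝ
  1ℝ = ℝ.1#

  infixl 7 _÷_
  _÷_ : ℝ → ℕ⁺ → ℝ
  x ÷ n = x ℝ.* ℝ.fromℕ (value n) ℝ.⁻¹

  -- The largest n ≤ bound with n ≤ x, or 0 if there is none.
  searchBelow : ℝ → (bound : ℕ) → ℕ
  searchBelow x zero = zero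
  searchBelow x (suc b) with ℝ.fromℕ (suc b) ℝ.≤? x
  ... | yes _ = suc b
  ... | no  _ = searchBelow x b

  -- The integer part of x for x ≥ 0; negative reals are sent to 0.
  ⌊_⌋ : ℝ → ℕ
  ⌊ x ⌋ with ℝ.archimedean x
  ... | b , _ = searchBelow x b

  -- Complex numbers are pairs (real part , imaginary part), with
  -- componentwise addition and equality.
  ℂ-+-commutativeMonoid : CommutativeMonoid c ℓ₁
  ℂ-+-commutativeMonoid =
    commutativeMonoid ℝ.+-commutativeMonoid ℝ.+-commutativeMonoid

  open CommutativeMonoid ℂ-+-commutativeMonoid public using ()
    renaming (Carrier to ℂ; _≈_ to _≈ℂ_; _∙_ to _+ℂ_; ε to 0ℂ)
  open RawMonoidDefs (CommutativeMonoid.rawMonoid ℂ-+-commutativeMonoid) public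
    using (sum)

  infixl 7 _*ℂ_
  _*ℂ_ : ℂ → ℂ → ℂ
  (a , b) *ℂ (a′ , b′) =
    (a ℝ.* a′ ℝ.- b ℝ.* b′) , (a ℝ.* b′ ℝ.+ b ℝ.* a′)

  fromℕℂ : ℕ → ℂ
  fromℕℂ n = ℝ.fromℕ n , ℝ.0#

  -- As n ranges over integers, n ≤ x means n ≤ ⌊ x ⌋.
  ∑≤ : ℝ → (ℕ⁺ → ℂ) → ℂ
  ∑≤ x g = sum {⌊ x ⌋} (λ i → g (index⁺ i))

  syntax ∑≤ x (λ n → e) = ∑[ n ≤ x ] e
  infixr 5 ∑≤

  -- The sum over all r-tuples of positive integers with entries at most x.
  ∑tuples : (r : ℕ) → ℝ → (Vector ℕ⁺ r → ℂ) → ℂ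
  ∑tuples zero    x g = g []
  ∑tuples (suc r) x g = ∑[ n ≤ x ] ∑tuples r x (λ ns → g (n ∷ ns))

  module _ (F G : ℕ⁺ → ℂ) (n : ℕ⁺) where

    divisorTerm : (d : ℕ⁺) → Dec (value d ∣ value n) → ℂ
    divisorTerm d (yes d∣n) = F d *ℂ G (quotient⁺ n d∣n)
    divisorTerm d (no _)    = 0ℂ

    -- Every divisor of n lies in 1, …, n.
    dirichlet : ℂ
    dirichlet = sum {value n}
      (λ i → divisorTerm (index⁺ i) (value (index⁺ i) ∣? value n))

  infixl 7 _⋆_
  _⋆_ : (ℕ⁺ → ℂ) → (ℕ⁺ → ℂ) → (ℕ⁺ → ℂ)
  F ⋆ G = dirichlet F G

  𝟏 : ℕ⁺ → ℂ
  𝟏 _ = fromℕℂ 1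

  S : (ℕ⁺ → ℂ) → ℕ → ℝ → ℂ
  S f r x = ∑tuples r x λ ns →
    sum (λ i → f (ns i)) *ℂ fromℕℂ ⌊ x ÷ product⁺ ns ⌋

  T : (ℕ⁺ → ℂ) → (r : ℕ) → .{{NonZero r}} → ℝ → ℂ
  T f (suc zero)    x = ∑[ n ≤ x ] (fromℕℂ ⌊ x ÷ n ⌋ *ℂ (f ⋆ 𝟏) n)
  T f (suc (suc r)) x = ∑[ n ≤ x ] T f (suc r) (x ÷ n)

{-# OPTIONS --safe #-}

-- Since ⌊ x ÷ n ⌋ = ⌊ x ⌋ / n, both sides depend only on N = ⌊ x ⌋.  Terms
-- with vanishing integer part may be added or dropped, so every range of
-- summation can be enlarged, and double sums over n m ≤ N can be reordered.
-- Writing D r a N for the sum of a ⌊ N / (n₁ ⋯ nᵣ) ⌋ over all r-tuples and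
-- E r N for the sum of D r (f n) ⌊ N / n ⌋ over n ≤ N, this gives
-- T r = E r (for r = 1 by writing n = d e).  Splitting off the first index
-- shows that S r = F r with F (1 + r) N = E r N + ∑ F r ⌊ N / n ⌋, whence
-- S (1 + r) = (1 + r) E r.
module Submission where

open import Defs
open import Algebra.Bundles using (CommutativeMonoid; CommutativeRing)
import Algebra.Properties.CommutativeMonoid.Mult as CommutativeMonoidMult
import Algebra.Properties.CommutativeMonoid.Sum as CommutativeMonoidSum
import Algebra.Properties.Group as GroupProperties
import Algebra.Properties.Ring as RingProperties
import Algebra.Properties.Semiring.Mult as SemiringMult
open import Data.Fin.Base using (Fin; zero; suc; toℕ; fromℕ<; punchIn)
open import Data.Fin.Properties using (toℕ<n; toℕ-fromℕ<; toℕ-injective; punchInᵢ≢i)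
open import Data.Nat.Base as ℕ using (ℕ; zero; suc; _≤_; _<_; _∸_; z≤n; s≤s; NonZero; >-nonZero)
open import Data.Nat.Divisibility using (_∣_; _∣?_; divides)
open import Data.Nat.DivMod
  using (_/_; m<n⇒m/n≡0; m*n/n≡m; /-monoˡ-≤; m/n*n≤m; m/n≤m; m/n/o≡m/[n*o])
import Data.Nat.Properties as ℕ
open import Data.Nat.Properties using (m<n⇒0<n∸m)
open import Data.Product.Base using (_,_)
open import Data.Sum.Base using (inj₁; inj₂)
open import Data.Vec.Functional using (Vector; _∷_)
open import Function.Base using (_∘_)
open import Function.Bundles using (_⇔_; mk⇔; Equivalence)
open import Level using (Level)
open import Relation.Binary.PropositionalEquality as ≡ using (_≡_; _≢_)
open import Relation.Binary.Structures using (IsDecTotalOrder)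
import Relation.Binary.Reasoning.Setoid as SetoidReasoning
open import Relation.Nullary.Decidable using (Dec; yes; no)
open import Relation.Nullary.Negation using (¬_; contradiction)

-- Integer division by positive integers.

infixl 7 _/⁺_
_/⁺_ : ℕ → ℕ⁺ → ℕ
N /⁺ mk⁺ n = N / n

/⁺-zero : ∀ {N} n → N < value n → N /⁺ n ≡ 0
/⁺-zero (mk⁺ n) N<n = m<n⇒m/n≡0 N<n

/⁺-≤ : ∀ N n → N /⁺ n ≤ N
/⁺-≤ N (mk⁺ n) = m/n≤m N n

/⁺-assoc : ∀ N m n → N /⁺ (m *⁺ n) ≡ N /⁺ m /⁺ n
/⁺-assoc N (mk⁺ m) (mk⁺ n) =
  ≡.sym (m/n/o≡m/[n*o] N m n {{_}} {{_}} {{ℕ.m*n≢0 m n}})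

/⁺-comm : ∀ N m n → N /⁺ m /⁺ n ≡ N /⁺ n /⁺ m
/⁺-comm N m n = ≡.trans (≡.sym (/⁺-assoc N m n))
  (≡.trans (≡.cong (N /⁺_) (value-injective (ℕ.*-comm (value m) (value n))))
           (/⁺-assoc N n m))
  where
  value-injective : ∀ {m n} → value m ≡ value n → m ≡ n
  value-injective ≡.refl = ≡.refl

n/1⁺≡n : ∀ N → N /⁺ 1⁺ ≡ N
n/1⁺≡n N = ≡.trans (≡.cong (_/ 1) (≡.sym (ℕ.*-identityʳ N))) (m*n/n≡m N 1)

-- Finite sums in a commutative monoid and changes of their range.

module FloorSums {c ℓ : Level} (M : CommutativeMonoid c ℓ) where

  open CommutativeMonoid M
    renaming
    ( _∙_ to _+_; ε to 0#; ∙-congˡ to +-congˡ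
    ; identityˡ to +-identityˡ; identityʳ to +-identityʳ )
  open CommutativeMonoidSum M
    using (sum; sum-cong-≋; sum-replicate-zero; sum-remove; ∑-distrib-+; ∑-comm)
  open CommutativeMonoidMult M
    using (_×_; ×-congʳ; ×-congˡ; ×-distrib-+)
  open SetoidReasoning setoid

  sum-zero : ∀ {n} (t : Vector Carrier n) → (∀ i → t i ≈ 0#) → sum t ≈ 0#
  sum-zero {n} t t≈0 = trans (sum-cong-≋ t≈0) (sum-replicate-zero n)

  sum-single : ∀ {n} (t : Vector Carrier n) i →
               (∀ j → j ≢ i → t j ≈ 0#) → sum t ≈ t i
  sum-single {suc n} t i t≈0 = begin
    sum t                              ≈⟨ sum-remove t ⟩
    t i + sum (λ j → t (punchIn i j))  ≈⟨ +-congˡ (sum-zero _ λ j → t≈0 _ (punchInᵢ≢i i j)) ⟩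
    t i + 0#                           ≈⟨ +-identityʳ (t i) ⟩
    t i                                ∎

  sum-extend : ∀ {m n} (g : ℕ → Carrier) → m ≤ n → (∀ k → m ≤ k → g k ≈ 0#) →
               sum {m} (g ∘ toℕ) ≈ sum {n} (g ∘ toℕ)
  sum-extend {n = n} g z≤n g≈0 = sym (sum-zero {n} (g ∘ toℕ) λ i → g≈0 (toℕ i) z≤n)
  sum-extend g (s≤s m≤n) g≈0 =
    +-congˡ (sum-extend (g ∘ suc) m≤n λ k m≤k → g≈0 (suc k) (s≤s m≤k))

  ×-zeroʳ : ∀ n → n × 0# ≈ 0#
  ×-zeroʳ zero    = refl
  ×-zeroʳ (suc n) = trans (+-identityˡ _) (×-zeroʳ n)

  ×-distrib-sum : ∀ k {n} (t : Vector Carrier n) → k × sum t ≈ sum (λ i → k × t i)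
  ×-distrib-sum k {zero}  t = ×-zeroʳ k
  ×-distrib-sum k {suc n} t =
    trans (×-distrib-+ (t zero) _ k) (+-congˡ (×-distrib-sum k (t ∘ suc)))

  -- Opaque, so that Agda can infer g from ∑upto N g.
  opaque

    ∑upto : ℕ → (ℕ⁺ → Carrier) → Carrier
    ∑upto N g = sum {N} (λ i → g (index⁺ i))

    ∑upto≡sum : ∀ N g → ∑upto N g ≡ sum {N} (λ i → g (index⁺ i))
    ∑upto≡sum N g = ≡.refl

    ∑upto-cong : ∀ N {g h : ℕ⁺ → Carrier} → (∀ n → value n ≤ N → g n ≈ h n) →
                 ∑upto N g ≈ ∑upto N h
    ∑upto-cong N g≈h = sum-cong-≋ λ i → g≈h (index⁺ i) (toℕ<n i)

    ∑upto-empty : ∀ g → ∑upto 0 g ≈ 0#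
    ∑upto-empty g = refl

    ∑upto-zero : ∀ N {g : ℕ⁺ → Carrier} → (∀ n → value n ≤ N → g n ≈ 0#) → ∑upto N g ≈ 0#
    ∑upto-zero N g≈0 = sum-zero {N} _ λ i → g≈0 (index⁺ i) (toℕ<n i)

    ∑upto-comm : ∀ N B (g : ℕ⁺ → ℕ⁺ → Carrier) →
                 ∑upto N (λ m → ∑upto B (g m)) ≈ ∑upto B (λ n → ∑upto N (λ m → g m n))
    ∑upto-comm N B g = ∑-comm {N} {B} (λ i j → g (index⁺ i) (index⁺ j))

    ∑upto-distrib-+ : ∀ N (g h : ℕ⁺ → Carrier) →
                      ∑upto N (λ n → g n + h n) ≈ ∑upto N g + ∑upto N h
    ∑upto-distrib-+ N g h = ∑-distrib-+ {N} (g ∘ index⁺) (h ∘ index⁺)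

    ×-distrib-∑upto : ∀ k N (g : ℕ⁺ → Carrier) → k × ∑upto N g ≈ ∑upto N (λ n → k × g n)
    ×-distrib-∑upto k N g = ×-distrib-sum k {N} (g ∘ index⁺)

    ∑upto-extend : ∀ {N B} (g : ℕ⁺ → Carrier) → N ≤ B →
                   (∀ n → N < value n → g n ≈ 0#) → ∑upto N g ≈ ∑upto B g
    ∑upto-extend g N≤B g≈0 =
      sum-extend (λ k → g (mk⁺ (suc k))) N≤B λ k N≤k → g≈0 (mk⁺ (suc k)) (s≤s N≤k)

    ∑upto-single : ∀ {N} (g : ℕ⁺ → Carrier) m → value m ≤ N →
                   (∀ n → value n ≢ value m → g n ≈ 0#) → ∑upto N g ≈ g m
    ∑upto-single {N} g (mk⁺ (suc m)) m<N g≈0 = begin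
      ∑upto N g                  ≈⟨ sum-single (g ∘ index⁺) i (λ j j≢i → g≈0 (index⁺ j) (j≢i ∘ index-injective)) ⟩
      g (mk⁺ (suc (toℕ i)))      ≡⟨ ≡.cong (λ k → g (mk⁺ (suc k))) (toℕ-fromℕ< m<N) ⟩
      g (mk⁺ (suc m))            ∎
      where
      i : Fin N
      i = fromℕ< m<N
      index-injective : ∀ {j} → suc (toℕ j) ≡ suc m → j ≡ i
      index-injective eq =
        toℕ-injective (≡.trans (ℕ.suc-injective eq) (≡.sym (toℕ-fromℕ< m<N)))

  -- For `n` beyond `N` the quotient `N /⁺ n` is 0, so the new terms vanish. The quotient is a
  -- separate argument of `g` so that this can be asked of `g n 0`.
  ∑upto-extend-quotient : ∀ {N B} (g : ℕ⁺ → ℕ → Carrier) → N ≤ B → (∀ n → g n 0 ≈ 0#) →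
                          ∑upto N (λ n → g n (N /⁺ n)) ≈ ∑upto B (λ n → g n (N /⁺ n))
  ∑upto-extend-quotient {N} g N≤B g≈0 = ∑upto-extend (λ n → g n (N /⁺ n)) N≤B
    λ n N<n → trans (reflexive (≡.cong (g n) (/⁺-zero n N<n))) (g≈0 n)

  -- Both sides are sums over the pairs with m n ≤ N.
  ∑upto-swap-quotients : ∀ N (g : ℕ⁺ → ℕ → Carrier) → (∀ m → g m 0 ≈ 0#) →
    ∑upto N (λ n → ∑upto (N /⁺ n) (λ m → g m (N /⁺ n /⁺ m))) ≈
    ∑upto N (λ m → ∑upto (N /⁺ m) (λ n → g m (N /⁺ m /⁺ n)))
  ∑upto-swap-quotients N g g≈0 = begin
    ∑upto N (λ n → ∑upto (N /⁺ n) (λ m → g m (N /⁺ n /⁺ m)))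
      ≈⟨ ∑upto-cong N (λ n _ → ∑upto-extend-quotient g (/⁺-≤ N n) g≈0) ⟩
    ∑upto N (λ n → ∑upto N (λ m → g m (N /⁺ n /⁺ m)))
      ≈⟨ ∑upto-comm N N _ ⟩
    ∑upto N (λ m → ∑upto N (λ n → g m (N /⁺ n /⁺ m)))
      ≈⟨ ∑upto-cong N (λ m _ → ∑upto-cong N λ n _ → reflexive (≡.cong (g m) (/⁺-comm N n m))) ⟩
    ∑upto N (λ m → ∑upto N (λ n → g m (N /⁺ m /⁺ n)))
      ≈⟨ ∑upto-cong N (λ m _ → ∑upto-extend-quotient (λ _ → g m) (/⁺-≤ N m) (λ _ → g≈0 m)) ⟨
    ∑upto N (λ m → ∑upto (N /⁺ m) (λ n → g m (N /⁺ m /⁺ n)))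
      ∎

  -- Divisor sums as sums over pairs of divisor and cofactor.

  infix 6 _when_
  -- An indicator: it moves a condition from the range of summation into the summand, so that sums
  -- over fixed ranges can be interchanged.
  _when_ : {p : Level} {P : Set p} → Carrier → Dec P → Carrier
  a when yes _ = a
  a when no  _ = 0#

  when-true : ∀ {p} {P : Set p} (a : Carrier) (d : Dec P) → P → a when d ≈ a
  when-true a (yes _)  _ = refl
  when-true a (no ¬p)  p = contradiction p ¬p

  when-false : ∀ {p} {P : Set p} (a : Carrier) (d : Dec P) → ¬ P → a when d ≈ 0#
  when-false a (yes p) ¬p = contradiction p ¬p
  when-false a (no _)  _  = refl

  ×-when : ∀ {p} {P : Set p} k (a : Carrier) (d : Dec P) → k × (a when d) ≈ (k × a) when d
  ×-when k a (yes _) = refl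
  ×-when k a (no _)  = ×-zeroʳ k

  infix 4 _*⁺_≟_
  _*⁺_≟_ : (d e n : ℕ⁺) → Dec (value d ℕ.* value e ≡ value n)
  d *⁺ e ≟ n = value d ℕ.* value e ℕ.≟ value n

  -- If `d` divides `n`, exactly one `e` satisfies `d e = n`, and it lies in range because it is at
  -- most `n`; otherwise no `e` does.
  ∑-cofactors : ∀ {N} d n (a : Carrier) → value n ≤ N → (d∣?n : Dec (value d ∣ value n)) →
                ∑upto N (λ e → a when (d *⁺ e ≟ n)) ≈ a when d∣?n
  -- Only a positive quotient is possible: a zero quotient would make the successor `n` equal to 0.
  ∑-cofactors {N} d@(mk⁺ (suc d′)) n@(mk⁺ (suc n′)) a n≤N (yes d∣n@(divides q@(suc q′) n≡q*d)) = begin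
    ∑upto N (λ e → a when (d *⁺ e ≟ n))  ≈⟨ ∑upto-single _ (mk⁺ q) q≤N off ⟩
    a when (d *⁺ mk⁺ q ≟ n)              ≈⟨ when-true a (d *⁺ mk⁺ q ≟ n) d*q≡n ⟩
    a                                    ∎
    where
    d*q≡n : value d ℕ.* q ≡ value n
    d*q≡n = ≡.trans (ℕ.*-comm (value d) q) (≡.sym n≡q*d)
    q≤N : q ≤ N
    q≤N = ℕ.≤-trans (ℕ.m≤m*n q (value d)) (ℕ.≤-trans (ℕ.≤-reflexive (≡.sym n≡q*d)) n≤N)
    off : ∀ e → value e ≢ q → a when (d *⁺ e ≟ n) ≈ 0#
    off e e≢q = when-false a (d *⁺ e ≟ n) λ d*e≡n →
      e≢q (ℕ.*-cancelˡ-≡ (value e) q (value d) (≡.trans d*e≡n (≡.sym d*q≡n)))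
  ∑-cofactors {N} d n a n≤N (no ¬d∣n) = ∑upto-zero N λ e _ →
    when-false a (d *⁺ e ≟ n) λ d*e≡n →
      ¬d∣n (divides (value e) (≡.trans (≡.sym d*e≡n) (ℕ.*-comm (value d) (value e))))

  -- Summing over n = d e ≤ N by divisor and cofactor.
  ∑-divisors : ∀ N (f : ℕ⁺ → Carrier) →
    ∑upto N (λ n → (N /⁺ n) × ∑upto (value n) (λ d → f d when (value d ∣? value n))) ≈
    ∑upto N (λ d → ∑upto (N /⁺ d) (λ e → (N /⁺ d /⁺ e) × f d))
  ∑-divisors N f = begin
    ∑upto N (λ n → (N /⁺ n) × ∑upto (value n) (λ d → f d when (value d ∣? value n)))
      ≈⟨ ∑upto-cong N (λ n n≤N → trans (×-congʳ (N /⁺ n) (divisors n n≤N)) (distrib n)) ⟩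
    ∑upto N (λ n → ∑upto N (λ d → ∑upto N (λ e → term n d e)))
      ≈⟨ ∑upto-comm N N _ ⟩
    ∑upto N (λ d → ∑upto N (λ n → ∑upto N (λ e → term n d e)))
      ≈⟨ ∑upto-cong N (λ d _ → ∑upto-comm N N _) ⟩
    ∑upto N (λ d → ∑upto N (λ e → ∑upto N (λ n → term n d e)))
      ≈⟨ ∑upto-cong N (λ d _ → ∑upto-cong N λ e _ → trans (collapse d e (value (d *⁺ e) ℕ.≤? N))
           (×-congˡ (/⁺-assoc N d e))) ⟩
    ∑upto N (λ d → ∑upto N (λ e → (N /⁺ d /⁺ e) × f d))
      ≈⟨ ∑upto-cong N (λ d _ → ∑upto-extend-quotient (λ _ k → k × f d) (/⁺-≤ N d) (λ _ → refl)) ⟨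
    ∑upto N (λ d → ∑upto (N /⁺ d) (λ e → (N /⁺ d /⁺ e) × f d))
      ∎
    where
    term : (n d e : ℕ⁺) → Carrier
    term n d e = ((N /⁺ n) × f d) when (d *⁺ e ≟ n)

    -- After the condition is spread over cofactors, the range of `d` may grow from `n` to `N`: for
    -- `d > n` no positive `e` gives `d e = n`.
    divisors : ∀ n → value n ≤ N →
      ∑upto (value n) (λ d → f d when (value d ∣? value n)) ≈
      ∑upto N (λ d → ∑upto N (λ e → f d when (d *⁺ e ≟ n)))
    divisors n n≤N = begin
      ∑upto (value n) (λ d → f d when (value d ∣? value n))
        ≈⟨ ∑upto-cong (value n) (λ d _ → ∑-cofactors d n (f d) n≤N (value d ∣? value n)) ⟨
      ∑upto (value n) (λ d → ∑upto N (λ e → f d when (d *⁺ e ≟ n)))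
        ≈⟨ ∑upto-extend _ n≤N (λ d n<d → ∑upto-zero N λ e _ →
             when-false (f d) (d *⁺ e ≟ n) (too-large d e n<d)) ⟩
      ∑upto N (λ d → ∑upto N (λ e → f d when (d *⁺ e ≟ n)))
        ∎
      where
      too-large : ∀ d e → value n < value d → value d ℕ.* value e ≢ value n
      too-large d (mk⁺ e) n<d d*e≡n =
        ℕ.<-irrefl (≡.sym d*e≡n) (ℕ.<-≤-trans n<d (ℕ.m≤m*n (value d) e))

    distrib : ∀ n → (N /⁺ n) × ∑upto N (λ d → ∑upto N (λ e → f d when (d *⁺ e ≟ n))) ≈
                    ∑upto N (λ d → ∑upto N (λ e → term n d e))
    distrib n = trans (×-distrib-∑upto (N /⁺ n) N _) (∑upto-cong N λ d _ →
      trans (×-distrib-∑upto (N /⁺ n) N _) (∑upto-cong N λ e _ →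
      ×-when (N /⁺ n) (f d) (d *⁺ e ≟ n)))

    -- Only the term `n = d e` survives. If `d e` exceeds `N` there is no such term, but then the
    -- multiplier `N /⁺ (d *⁺ e)` is 0 as well.
    collapse : ∀ d e → Dec (value (d *⁺ e) ≤ N) →
               ∑upto N (λ n → term n d e) ≈ (N /⁺ (d *⁺ e)) × f d
    collapse d e (yes de≤N) = trans
      (∑upto-single (λ n → term n d e) (d *⁺ e) de≤N λ n n≢de →
        when-false _ (d *⁺ e ≟ n) (n≢de ∘ ≡.sym))
      (when-true _ (d *⁺ e ≟ d *⁺ e) ≡.refl)
    collapse d e (no de≰N) = trans
      (∑upto-zero N λ n n≤N → when-false _ (d *⁺ e ≟ n)
        λ de≡n → de≰N (≡.subst (_≤ N) (≡.sym de≡n) n≤N))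
      (×-congˡ (≡.sym (/⁺-zero (d *⁺ e) (ℕ.≰⇒> de≰N))))

  -- Iterated quotient sums and their recursions.

  D : ℕ → Carrier → ℕ → Carrier
  D zero    a N = N × a
  D (suc r) a N = ∑upto N (λ n → D r a (N /⁺ n))

  D-zero : ∀ r a → D r a 0 ≈ 0#
  D-zero zero    a = refl
  D-zero (suc r) a = ∑upto-empty _

  module _ (f : ℕ⁺ → Carrier) where

    E : ℕ → ℕ → Carrier
    E r N = ∑upto N (λ n → D r (f n) (N /⁺ n))

    -- Both sides unfold to double sums of `D r (f m)` at the quotient of `N` by `n m`, taken in
    -- opposite orders. This is the recursion that defines `T`.
    E-suc : ∀ r N → ∑upto N (λ n → E r (N /⁺ n)) ≈ E (suc r) N
    E-suc r N = ∑upto-swap-quotients N (λ m → D r (f m)) (λ m → D-zero r (f m))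

    F : ℕ → ℕ → Carrier
    F zero    N = 0#
    F (suc r) N = ∑upto N (λ n → D r (f n) (N /⁺ n) + F r (N /⁺ n))

    F-zero : ∀ r → F r 0 ≈ 0#
    F-zero zero    = refl
    F-zero (suc r) = ∑upto-empty _

    -- All `suc r` indices contribute equally: the first gives `E r N` directly, and the others give
    -- `r` further copies by induction.
    F≈×E : ∀ r N → F (suc r) N ≈ suc r × E r N
    F≈×E r N = trans (∑upto-distrib-+ N _ _) (+-congˡ (tail r))
      where
      -- Mutual induction: at `suc r` this calls `F≈×E` at `r`, with each `N /⁺ n` in place of `N`.
      tail : ∀ r → ∑upto N (λ n → F r (N /⁺ n)) ≈ r × E r N
      tail zero    = ∑upto-zero N λ _ _ → refl
      tail (suc r) = begin
        ∑upto N (λ n → F (suc r) (N /⁺ n))    ≈⟨ ∑upto-cong N (λ n _ → F≈×E r (N /⁺ n)) ⟩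
        ∑upto N (λ n → suc r × E r (N /⁺ n))  ≈⟨ ×-distrib-∑upto (suc r) N _ ⟨
        suc r × ∑upto N (λ n → E r (N /⁺ n))  ≈⟨ ×-congʳ (suc r) (E-suc r N) ⟩
        suc r × E (suc r) N                   ∎

-- Ordered-field facts and the integer part.

module IntegerPart {c ℓ₁ ℓ₂ : Level} (R : Reals c ℓ₁ ℓ₂) where

  open Arithmetic R
  open Reals R hiding (_≤_) renaming (_≤?_ to _≤ℝ?_)
  open IsDecTotalOrder isDecTotalOrder using (antisym; total; ≤-respˡ-≈; ≤-respʳ-≈)
    renaming (trans to ≤-trans; refl to ≤-refl)
  open RingProperties (CommutativeRing.ring commutativeRing)
    using (-‿distribʳ-*; [y-z]x≈yx-zx)
  open GroupProperties +-group using (⁻¹-involutive; ⁻¹-anti-homo-∙)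
    renaming (//-rightDividesˡ to x-y+y≈x)
  open SemiringMult semiring using (×-homo-+; ×1-homo-*)
  open SetoidReasoning setoid

  x≤y⇒0≤y-x : ∀ {x y} → x ≤ℝ y → 0# ≤ℝ y - x
  x≤y⇒0≤y-x {x} x≤y = ≤-respˡ-≈ (-‿inverseʳ x) (+-monoˡ-≤ (- x) x≤y)

  0≤y-x⇒x≤y : ∀ {x y} → 0# ≤ℝ y - x → x ≤ℝ y
  0≤y-x⇒x≤y {x} {y} 0≤y-x =
    ≤-respʳ-≈ (x-y+y≈x x y) (≤-respˡ-≈ (+-identityˡ x) (+-monoˡ-≤ x 0≤y-x))

  x≤0⇒0≤-x : ∀ {x} → x ≤ℝ 0# → 0# ≤ℝ - x
  x≤0⇒0≤-x {x} x≤0 = ≤-respʳ-≈ (+-identityˡ (- x)) (x≤y⇒0≤y-x x≤0)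

  *-monoˡ-≤ : ∀ {x y z} → 0# ≤ℝ z → x ≤ℝ y → x * z ≤ℝ y * z
  *-monoˡ-≤ {x} {y} {z} 0≤z x≤y = 0≤y-x⇒x≤y
    (≤-respʳ-≈ ([y-z]x≈yx-zx z y x) (*-nonNegative (x≤y⇒0≤y-x x≤y) 0≤z))

  0≤1 : 0# ≤ℝ 1#
  0≤1 with total 0# 1#
  ... | inj₁ 0≤1 = 0≤1
  ... | inj₂ 1≤0 = ≤-respʳ-≈ -1*-1≈1 (*-nonNegative (x≤0⇒0≤-x 1≤0) (x≤0⇒0≤-x 1≤0))
    where
    -1*-1≈1 : - 1# * - 1# ≈ 1#
    -1*-1≈1 = trans (sym (-‿distribʳ-* (- 1#) 1#))
      (trans (-‿cong (*-identityʳ (- 1#))) (⁻¹-involutive 1#))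

  1≰0 : ¬ 1# ≤ℝ 0#
  1≰0 1≤0 = 1≉0 (antisym 1≤0 0≤1)

  0≤fromℕ : ∀ n → 0# ≤ℝ fromℕ n
  1≤fromℕ-suc : ∀ n → 1# ≤ℝ fromℕ (suc n)

  0≤fromℕ zero    = ≤-refl
  0≤fromℕ (suc n) = ≤-trans 0≤1 (1≤fromℕ-suc n)

  1≤fromℕ-suc n = ≤-respʳ-≈ (+-comm (fromℕ n) 1#)
    (≤-respˡ-≈ (+-identityˡ 1#) (+-monoˡ-≤ 1# (0≤fromℕ n)))

  fromℕ-suc≉0 : ∀ n → ¬ fromℕ (suc n) ≈ 0#
  fromℕ-suc≉0 n n≈0 = 1≰0 (≤-respʳ-≈ n≈0 (1≤fromℕ-suc n))

  fromℕ-mono-≤ : ∀ {m n} → m ≤ n → fromℕ m ≤ℝ fromℕ n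
  fromℕ-mono-≤ {m} {n} m≤n = ≤-respʳ-≈ n-m+m≈n
    (≤-respˡ-≈ (+-identityˡ (fromℕ m)) (+-monoˡ-≤ (fromℕ m) (0≤fromℕ (n ∸ m))))
    where
    n-m+m≈n : fromℕ (n ∸ m) + fromℕ m ≈ fromℕ n
    n-m+m≈n = trans (sym (×-homo-+ 1# (n ∸ m) m)) (reflexive (≡.cong fromℕ (ℕ.m∸n+n≡m m≤n)))

  -- Were `m > n`, then `1 + n ≤ n` would hold among the reals, and cancelling `n` would leave
  -- `1 ≤ 0`.
  fromℕ-cancel-≤ : ∀ {m n} → fromℕ m ≤ℝ fromℕ n → m ≤ n
  fromℕ-cancel-≤ {m} {n} fm≤fn with m ℕ.≤? n
  ... | yes m≤n = m≤n
  ... | no m≰n = contradiction (0≤y-x⇒x≤y (≤-respʳ-≈ fn-f[1+n]≈0-1 (x≤y⇒0≤y-x f[1+n]≤fn))) 1≰0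
    where
    f[1+n]≤fn : 1# + fromℕ n ≤ℝ fromℕ n
    f[1+n]≤fn = ≤-trans (fromℕ-mono-≤ (ℕ.≰⇒> m≰n)) fm≤fn
    fn-f[1+n]≈0-1 : fromℕ n - (1# + fromℕ n) ≈ 0# - 1#
    fn-f[1+n]≈0-1 = begin
      fromℕ n - (1# + fromℕ n)        ≈⟨ +-congˡ (⁻¹-anti-homo-∙ 1# (fromℕ n)) ⟩
      fromℕ n + (- fromℕ n - 1#)      ≈⟨ +-assoc (fromℕ n) (- fromℕ n) (- 1#) ⟨
      fromℕ n - fromℕ n - 1#          ≈⟨ +-congʳ (-‿inverseʳ (fromℕ n)) ⟩
      0# - 1#                         ∎

  -- A nonpositive inverse would make the product of `suc n` with its negated inverse nonnegative,
  -- but that product is -1.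
  0≤fromℕ⁻¹ : ∀ n → 0# ≤ℝ fromℕ (suc n) ⁻¹
  0≤fromℕ⁻¹ n with total 0# (fromℕ (suc n) ⁻¹)
  ... | inj₁ 0≤n⁻¹ = 0≤n⁻¹
  ... | inj₂ n⁻¹≤0 = contradiction (0≤y-x⇒x≤y (≤-respʳ-≈ n*-n⁻¹≈0-1
                       (*-nonNegative (0≤fromℕ (suc n)) (x≤0⇒0≤-x n⁻¹≤0)))) 1≰0
    where
    n*-n⁻¹≈0-1 : fromℕ (suc n) * - (fromℕ (suc n) ⁻¹) ≈ 0# - 1#
    n*-n⁻¹≈0-1 = begin
      fromℕ (suc n) * - (fromℕ (suc n) ⁻¹)  ≈⟨ -‿distribʳ-* (fromℕ (suc n)) (fromℕ (suc n) ⁻¹) ⟨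
      - (fromℕ (suc n) * fromℕ (suc n) ⁻¹)  ≈⟨ -‿cong (⁻¹-inverseʳ _ (fromℕ-suc≉0 n)) ⟩
      - 1#                                  ≈⟨ +-identityˡ (- 1#) ⟨
      0# - 1#                               ∎

  -- Multiplication by the nonnegative reals `fromℕ n ⁻¹` and `fromℕ n` preserves the order, which
  -- gives the two directions.
  fromℕ-*-≤⇔≤-÷ : ∀ k n x → fromℕ (k ℕ.* value n) ≤ℝ x ⇔ fromℕ k ≤ℝ x ÷ n
  fromℕ-*-≤⇔≤-÷ k (mk⁺ n@(suc n′)) x = mk⇔
    (λ kn≤x → ≤-respˡ-≈ kn*n⁻¹≈k (*-monoˡ-≤ (0≤fromℕ⁻¹ n′) kn≤x))
    (λ k≤x÷n → ≤-respʳ-≈ xn⁻¹*n≈x (≤-respˡ-≈ (sym (×1-homo-* k n)) (*-monoˡ-≤ (0≤fromℕ n) k≤x÷n)))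
    where
    kn*n⁻¹≈k : fromℕ (k ℕ.* n) * fromℕ n ⁻¹ ≈ fromℕ k
    kn*n⁻¹≈k = begin
      fromℕ (k ℕ.* n) * fromℕ n ⁻¹      ≈⟨ *-congʳ (×1-homo-* k n) ⟩
      fromℕ k * fromℕ n * fromℕ n ⁻¹    ≈⟨ *-assoc (fromℕ k) (fromℕ n) (fromℕ n ⁻¹) ⟩
      fromℕ k * (fromℕ n * fromℕ n ⁻¹)  ≈⟨ *-congˡ (⁻¹-inverseʳ _ (fromℕ-suc≉0 n′)) ⟩
      fromℕ k * 1#                      ≈⟨ *-identityʳ (fromℕ k) ⟩
      fromℕ k                           ∎
    xn⁻¹*n≈x : x * fromℕ n ⁻¹ * fromℕ n ≈ x
    xn⁻¹*n≈x = begin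
      x * fromℕ n ⁻¹ * fromℕ n    ≈⟨ *-assoc x (fromℕ n ⁻¹) (fromℕ n) ⟩
      x * (fromℕ n ⁻¹ * fromℕ n)  ≈⟨ *-congˡ (*-comm (fromℕ n ⁻¹) (fromℕ n)) ⟩
      x * (fromℕ n * fromℕ n ⁻¹)  ≈⟨ *-congˡ (⁻¹-inverseʳ _ (fromℕ-suc≉0 n′)) ⟩
      x * 1#                      ≈⟨ *-identityʳ x ⟩
      x                           ∎

  -- The bound is `suc k` because the result 0 is also the default of a failed search and then says
  -- nothing about `x`.
  <searchBelow⇒≤ : ∀ {k} x b → k < searchBelow x b → fromℕ (suc k) ≤ℝ x
  <searchBelow⇒≤ x (suc b) k<s with fromℕ (suc b) ≤ℝ? x
  ... | yes b≤x = ≤-trans (fromℕ-mono-≤ k<s) b≤x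
  ... | no  _   = <searchBelow⇒≤ x b k<s

  -- The search descends from `b`. A success at or above `suc k` settles the claim, and a failure at
  -- `suc k` itself would contradict the hypothesis.
  ≤⇒<searchBelow : ∀ {k} x b → k < b → fromℕ (suc k) ≤ℝ x → k < searchBelow x b
  ≤⇒<searchBelow x (suc b) k<b k≤x with fromℕ (suc b) ≤ℝ? x
  ... | yes _ = k<b
  ... | no b≰x with ℕ.m≤n⇒m<n∨m≡n (ℕ.≤-pred k<b)
  ...   | inj₁ k<b′   = ≤⇒<searchBelow x b k<b′ k≤x
  ...   | inj₂ ≡.refl = contradiction k≤x b≰x

  -- Positivity is needed because ⌊ x ⌋ is 0 for x < 0.
  ≤⌊⌋⇔≤ : ∀ k x .{{_ : NonZero k}} → k ≤ ⌊ x ⌋ ⇔ fromℕ k ≤ℝ x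
  ≤⌊⌋⇔≤ (suc k) x with archimedean x
  ... | b , x≤b = mk⇔ (<searchBelow⇒≤ x b)
    -- The search starts high enough: `suc k ≤ x ≤ b` among the reals gives `suc k ≤ b` among the
    -- naturals.
    (λ k≤x → ≤⇒<searchBelow x b (fromℕ-cancel-≤ (≤-trans k≤x x≤b)) k≤x)

  -- A natural number is determined by the positive `k` below it, and for these `k ≤ ⌊ x ÷ n ⌋`,
  -- `k n ≤ x`, `k n ≤ ⌊ x ⌋` and `k ≤ ⌊ x ⌋ / n` are equivalent.
  ⌊÷⌋ : ∀ x n → ⌊ x ÷ n ⌋ ≡ ⌊ x ⌋ /⁺ n
  ⌊÷⌋ x n⁺@(mk⁺ n) = ℕ.≤-antisym (≤-from-below ⌊x÷n⌋⇒) (≤-from-below ⌊x÷n⌋⇐)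
    where
    ≤-from-below : ∀ {i j} → (∀ k .{{_ : NonZero k}} → k ≤ i → k ≤ j) → i ≤ j
    ≤-from-below {zero}  _ = z≤n
    ≤-from-below {suc i} h = h (suc i) ℕ.≤-refl

    ⌊x÷n⌋⇒ : ∀ k .{{_ : NonZero k}} → k ≤ ⌊ x ÷ n⁺ ⌋ → k ≤ ⌊ x ⌋ / n
    ⌊x÷n⌋⇒ k k≤ = ℕ.≤-trans (ℕ.≤-reflexive (≡.sym (m*n/n≡m k n))) (/-monoˡ-≤ n
      (Equivalence.from (≤⌊⌋⇔≤ (k ℕ.* n) x {{ℕ.m*n≢0 k n}})
        (Equivalence.from (fromℕ-*-≤⇔≤-÷ k n⁺ x) (Equivalence.to (≤⌊⌋⇔≤ k (x ÷ n⁺)) k≤))))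

    ⌊x÷n⌋⇐ : ∀ k .{{_ : NonZero k}} → k ≤ ⌊ x ⌋ / n → k ≤ ⌊ x ÷ n⁺ ⌋
    ⌊x÷n⌋⇐ k k≤ = Equivalence.from (≤⌊⌋⇔≤ k (x ÷ n⁺)) (Equivalence.to (fromℕ-*-≤⇔≤-÷ k n⁺ x)
      (Equivalence.to (≤⌊⌋⇔≤ (k ℕ.* n) x {{ℕ.m*n≢0 k n}})
        (ℕ.≤-trans (ℕ.*-monoˡ-≤ n k≤) (m/n*n≤m ⌊ x ⌋ n))))

-- From the complex sums to sums of natural multiples.

module Main {c ℓ₁ ℓ₂ : Level} (R : Reals c ℓ₁ ℓ₂) where

  open Arithmetic R
  open IntegerPart R using (⌊÷⌋)
  open FloorSums ℂ-+-commutativeMonoid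
  open CommutativeMonoid ℂ-+-commutativeMonoid
    using (setoid; refl; trans; reflexive)
    renaming (∙-cong to +-cong)
  open CommutativeMonoidMult ℂ-+-commutativeMonoid
    using (_×_; ×-congʳ; ×-congˡ; ×-homo-1; ×-distrib-+)
  open SetoidReasoning setoid

  private module ℝ where
    open Reals R public
    open SemiringMult semiring public using (_×_; ×-comm-*; ×-congʳ)
    open RingProperties (CommutativeRing.ring commutativeRing) public using (-0#≈0#)

  ×-components : ∀ n a b → n × (a , b) ≡ (n ℝ.× a , n ℝ.× b)
  ×-components zero    a b = ≡.refl
  ×-components (suc n) a b = ≡.cong ((a , b) +ℂ_) (×-components n a b)

  -- Turns complex products with integer parts into repeated addition, so that the results for
  -- commutative monoids apply.
  *ℂ-fromℕℂ : ∀ z n → z *ℂ fromℕℂ n ≈ℂ n × z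
  *ℂ-fromℕℂ (a , b) n = trans (real , imaginary) (reflexive (≡.sym (×-components n a b)))
    where
    x*n≈n×x : ∀ x → x ℝ.* ℝ.fromℕ n ℝ.≈ n ℝ.× x
    x*n≈n×x x = ℝ.trans (ℝ.×-comm-* n x ℝ.1#) (ℝ.×-congʳ n (ℝ.*-identityʳ x))
    real : a ℝ.* ℝ.fromℕ n ℝ.- b ℝ.* ℝ.0# ℝ.≈ n ℝ.× a
    real = ℝ.trans (ℝ.+-cong (x*n≈n×x a) (ℝ.trans (ℝ.-‿cong (ℝ.zeroʳ b)) ℝ.-0#≈0#))
                   (ℝ.+-identityʳ _)
    imaginary : a ℝ.* ℝ.0# ℝ.+ b ℝ.* ℝ.fromℕ n ℝ.≈ n ℝ.× b
    imaginary = ℝ.trans (ℝ.+-cong (ℝ.zeroʳ a) (x*n≈n×x b)) (ℝ.+-identityˡ _)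

  *ℂ-comm : ∀ z w → z *ℂ w ≈ℂ w *ℂ z
  *ℂ-comm (a , b) (a′ , b′) =
    ℝ.+-cong (ℝ.*-comm a a′) (ℝ.-‿cong (ℝ.*-comm b b′)) ,
    ℝ.trans (ℝ.+-cong (ℝ.*-comm a b′) (ℝ.*-comm b a′)) (ℝ.+-comm _ _)

  fromℕℂ-*ℂ : ∀ n z → fromℕℂ n *ℂ z ≈ℂ n × z
  fromℕℂ-*ℂ n z = trans (*ℂ-comm (fromℕℂ n) z) (*ℂ-fromℕℂ z n)

  ∑≤≡∑upto : ∀ x g → ∑≤ x g ≡ ∑upto ⌊ x ⌋ g
  ∑≤≡∑upto x g = ≡.sym (∑upto≡sum ⌊ x ⌋ g)

  -- The right side is already an `∑upto`, so that one step both rewrites the summand and passes to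
  -- the opaque sum.
  ∑≤-cong : ∀ x {g h : ℕ⁺ → ℂ} → (∀ n → g n ≈ℂ h n) → ∑≤ x g ≈ℂ ∑upto ⌊ x ⌋ h
  ∑≤-cong x {g} g≈h =
    trans (reflexive (∑≤≡∑upto x g)) (∑upto-cong ⌊ x ⌋ λ n _ → g≈h n)

  ∑tuples-cong : ∀ r x {g h : Vector ℕ⁺ r → ℂ} → (∀ ns → g ns ≈ℂ h ns) →
                 ∑tuples r x g ≈ℂ ∑tuples r x h
  ∑tuples-cong zero    x g≈h = g≈h _
  ∑tuples-cong (suc r) x {g} {h} g≈h = trans
    (∑≤-cong x (λ n → ∑tuples-cong r x λ ns → g≈h (n ∷ ns)))
    (reflexive (≡.sym (∑≤≡∑upto x λ n → ∑tuples r x λ ns → h (n ∷ ns))))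

  ∑tuples-distrib-+ : ∀ r x (g h : Vector ℕ⁺ r → ℂ) →
    ∑tuples r x (λ ns → g ns +ℂ h ns) ≈ℂ ∑tuples r x g +ℂ ∑tuples r x h
  ∑tuples-distrib-+ zero    x g h = refl
  ∑tuples-distrib-+ (suc r) x g h = begin
    ∑tuples (suc r) x (λ ns → g ns +ℂ h ns)
      ≈⟨ ∑≤-cong x (λ n → ∑tuples-distrib-+ r x (λ ns → g (n ∷ ns)) (λ ns → h (n ∷ ns))) ⟩
    ∑upto ⌊ x ⌋ (λ n → ∑tuples r x (λ ns → g (n ∷ ns)) +ℂ ∑tuples r x (λ ns → h (n ∷ ns)))
      ≈⟨ ∑upto-distrib-+ ⌊ x ⌋ _ _ ⟩
    ∑upto ⌊ x ⌋ (λ n → ∑tuples r x (λ ns → g (n ∷ ns))) +ℂ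
    ∑upto ⌊ x ⌋ (λ n → ∑tuples r x (λ ns → h (n ∷ ns)))
      ≡⟨ ≡.cong₂ _+ℂ_ (∑≤≡∑upto x _) (∑≤≡∑upto x _) ⟨
    ∑tuples (suc r) x g +ℂ ∑tuples (suc r) x h
      ∎

  -- `N` is kept apart from `⌊ x ⌋` because in the induction the quotient shrinks while every index
  -- still runs up to `⌊ x ⌋`. The bound `N ≤ ⌊ x ⌋` lets the shorter ranges in `D` be extended.
  ∑tuples≈D : ∀ r x {N} a → N ≤ ⌊ x ⌋ →
              ∑tuples r x (λ ns → (N /⁺ product⁺ ns) × a) ≈ℂ D r a N
  ∑tuples≈D zero    x {N} a N≤x = ×-congˡ (n/1⁺≡n N)
  ∑tuples≈D (suc r) x {N} a N≤x = begin
    ∑tuples (suc r) x (λ ns → (N /⁺ product⁺ ns) × a)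
      ≈⟨ ∑≤-cong x (λ n → trans
           (∑tuples-cong r x λ ns → ×-congˡ (/⁺-assoc N n (product⁺ ns)))
           (∑tuples≈D r x a (ℕ.≤-trans (/⁺-≤ N n) N≤x))) ⟩
    ∑upto ⌊ x ⌋ (λ n → D r a (N /⁺ n))
      ≈⟨ ∑upto-extend-quotient (λ _ → D r a) N≤x (λ _ → D-zero r a) ⟨
    D (suc r) a N
      ∎

  module _ (f : ℕ⁺ → ℂ) where

    -- Induction on the first index `n`: its own summand `f n` is constant over the remaining tuple
    -- and yields `D`, while the rest is the same sum with one index fewer.
    ∑tuples≈F : ∀ r x {N} → N ≤ ⌊ x ⌋ →
      ∑tuples r x (λ ns → (N /⁺ product⁺ ns) × sum (λ i → f (ns i))) ≈ℂ F f r N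
    ∑tuples≈F zero    x {N} N≤x = ×-zeroʳ (N /⁺ 1⁺)
    ∑tuples≈F (suc r) x {N} N≤x = begin
      ∑tuples (suc r) x (λ ns → (N /⁺ product⁺ ns) × sum (λ i → f (ns i)))
        ≈⟨ ∑≤-cong x first-index ⟩
      ∑upto ⌊ x ⌋ (λ n → D r (f n) (N /⁺ n) +ℂ F f r (N /⁺ n))
        ≈⟨ ∑upto-extend-quotient (λ n k → D r (f n) k +ℂ F f r k) N≤x
             -- `×-zeroʳ 1` serves here as `0ℂ +ℂ 0ℂ ≈ℂ 0ℂ`, since `1 × 0ℂ` unfolds to that sum.
             (λ n → trans (+-cong (D-zero r (f n)) (F-zero f r)) (×-zeroʳ 1)) ⟨
      F f (suc r) N
        ∎
      where
      first-index : ∀ n →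
        ∑tuples r x (λ ns → (N /⁺ (n *⁺ product⁺ ns)) × (f n +ℂ sum (λ i → f (ns i)))) ≈ℂ
        D r (f n) (N /⁺ n) +ℂ F f r (N /⁺ n)
      first-index n = begin
        ∑tuples r x (λ ns → (N /⁺ (n *⁺ product⁺ ns)) × (f n +ℂ sum (λ i → f (ns i))))
          ≈⟨ ∑tuples-cong r x (λ ns → trans (×-congˡ (/⁺-assoc N n (product⁺ ns)))
               (×-distrib-+ (f n) (sum (λ i → f (ns i))) (N /⁺ n /⁺ product⁺ ns))) ⟩
        ∑tuples r x (λ ns → (N /⁺ n /⁺ product⁺ ns) × f n +ℂ
                            (N /⁺ n /⁺ product⁺ ns) × sum (λ i → f (ns i)))
          ≈⟨ ∑tuples-distrib-+ r x _ _ ⟩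
        ∑tuples r x (λ ns → (N /⁺ n /⁺ product⁺ ns) × f n) +ℂ
        ∑tuples r x (λ ns → (N /⁺ n /⁺ product⁺ ns) × sum (λ i → f (ns i)))
          ≈⟨ +-cong (∑tuples≈D r x (f n) N/n≤x) (∑tuples≈F r x N/n≤x) ⟩
        D r (f n) (N /⁺ n) +ℂ F f r (N /⁺ n)
          ∎
        where
        N/n≤x : N /⁺ n ≤ ⌊ x ⌋
        N/n≤x = ℕ.≤-trans (/⁺-≤ N n) N≤x

    S≈F : ∀ r x → S f r x ≈ℂ F f r ⌊ x ⌋
    S≈F r x = trans
      (∑tuples-cong r x λ ns → trans (*ℂ-fromℕℂ _ ⌊ x ÷ product⁺ ns ⌋) (×-congˡ (⌊÷⌋ x (product⁺ ns))))
      (∑tuples≈F r x ℕ.≤-refl)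

    ⋆𝟏 : ∀ n → (f ⋆ 𝟏) n ≈ℂ ∑upto (value n) (λ d → f d when (value d ∣? value n))
    ⋆𝟏 n = trans
      (reflexive (≡.sym (∑upto≡sum (value n) λ d → divisorTerm f 𝟏 n d (value d ∣? value n))))
      (∑upto-cong (value n) λ d _ → divisorTerm-𝟏 d (value d ∣? value n))
      where
      divisorTerm-𝟏 : ∀ d (d∣?n : Dec (value d ∣ value n)) →
                      divisorTerm f 𝟏 n d d∣?n ≈ℂ f d when d∣?n
      divisorTerm-𝟏 d (yes _) = trans (*ℂ-fromℕℂ (f d) 1) (×-homo-1 (f d))
      divisorTerm-𝟏 d (no _)  = refl

    T≈E : ∀ r x → T f (suc r) x ≈ℂ E f (suc r) ⌊ x ⌋
    T≈E zero x = begin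
      T f 1 x
        ≈⟨ ∑≤-cong x (λ n → trans (fromℕℂ-*ℂ ⌊ x ÷ n ⌋ ((f ⋆ 𝟏) n))
             (trans (×-congˡ (⌊÷⌋ x n)) (×-congʳ (⌊ x ⌋ /⁺ n) (⋆𝟏 n)))) ⟩
      ∑upto ⌊ x ⌋ (λ n → (⌊ x ⌋ /⁺ n) × ∑upto (value n) (λ d → f d when (value d ∣? value n)))
        -- The double sum over `d` and `e` produced here is `E f 1 ⌊ x ⌋` once `D 1` is unfolded.
        ≈⟨ ∑-divisors ⌊ x ⌋ f ⟩
      E f 1 ⌊ x ⌋
        ∎
    T≈E (suc r) x = begin
      T f (suc (suc r)) x
        ≈⟨ ∑≤-cong x (λ n → trans (T≈E r (x ÷ n)) (reflexive (≡.cong (E f (suc r)) (⌊÷⌋ x n)))) ⟩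
      ∑upto ⌊ x ⌋ (λ n → E f (suc r) (⌊ x ⌋ /⁺ n))
        ≈⟨ E-suc f (suc r) ⌊ x ⌋ ⟩
      E f (suc (suc r)) ⌊ x ⌋
        ∎

    S≈r*T : ∀ r x → S f (suc (suc r)) x ≈ℂ fromℕℂ (suc (suc r)) *ℂ T f (suc r) x
    S≈r*T r x = begin
      S f (suc (suc r)) x                         ≈⟨ S≈F (suc (suc r)) x ⟩
      F f (suc (suc r)) ⌊ x ⌋                     ≈⟨ F≈×E f (suc r) ⌊ x ⌋ ⟩
      suc (suc r) × E f (suc r) ⌊ x ⌋             ≈⟨ ×-congʳ (suc (suc r)) (T≈E r x) ⟨
      suc (suc r) × T f (suc r) x                 ≈⟨ fromℕℂ-*ℂ (suc (suc r)) (T f (suc r) x) ⟨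
      fromℕℂ (suc (suc r)) *ℂ T f (suc r) x       ∎

theorem5p1 : ∀ {c ℓ₁ ℓ₂} (R : Reals c ℓ₁ ℓ₂) → let open Arithmetic R in
    (f : ℕ⁺ → ℂ) (r : ℕ) (2≤r : 2 ≤ r) (x : ℝ) → 1ℝ ≤ℝ x →
    S f r x ≈ℂ fromℕℂ r *ℂ T f (r ∸ 1) {{>-nonZero (m<n⇒0<n∸m 2≤r)}} x
theorem5p1 R f (suc zero) (s≤s ()) x _
theorem5p1 R f (suc (suc r)) 2≤r x _ = Main.S≈r*T R f r x
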